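{- Let $\vec G=(G_0,\dots,G_n)$ be an fgv. Then $\vec G$ is compact if and only if $\vec G$ is rectifying.
   Context: Untyped $\lambda$-calculus; $=$ denotes $\beta$-conversion. $M\vec G=MG_0\cdots G_n$; $F^k(z)=F(F(\cdots F(z)\cdots))$ with $k$ copies of $F$. $M=^\infty N$ means $M$ and $N$ have the same Böhm tree. $Y$ is an fpc if $Yx=x(Yx)$ for $x$ not free in $Y$, a wfpc if $Yx=^\infty x(Yx)$; $\mathsf{FPC},\mathsf{WFPC}$ are the sets of these. $\vec G$ is an fgv if $Y\in\mathsf{FPC}\Rightarrow Y\vec G\in\mathsf{FPC}$. $\vec G$ is compact if, for a variable $z$ not free in $\vec G$, there is $k\ge0$ with $G_0^k(z)G_1\cdots G_n\in\mathsf{FPC}$. $\vec G$ is rectifying if $Y\in\mathsf{WFPC}$ implies $Y\vec G\in\mathsf{FPC}$. -}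

module Defs where

open import Data.Nat using (ℕ; zero; suc)
open import Data.List using (List; []; _∷_; map)
open import Data.Vec using (Vec; toList; head; tail)
open import Data.Product using (∃)
open import Data.List.Relation.Binary.Pointwise using (Pointwise)
open import Relation.Nullary using (¬_)

-- Untyped λ-terms with de Bruijn indices (variables are natural numbers;
-- free variables allowed).
data Term : Set where
  var : ℕ → Term
  app : Term → Term → Term
  lam : Term → Term

ext : (ℕ → ℕ) → ℕ → ℕ
ext ρ zero = zero
ext ρ (suc x) = suc (ρ x)

rename : (ℕ → ℕ) → Term → Term
rename ρ (var x) = var (ρ x)
rename ρ (app M N) = app (rename ρ M) (rename ρ N)
rename ρ (lam M) = lam (rename (ext ρ) M)

exts : (ℕ → Term) → ℕ → Term
exts σ zero = var zero
exts σ (suc x) = rename suc (σ x)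

sub : (ℕ → Term) → Term → Term
sub σ (var x) = σ x
sub σ (app M N) = app (sub σ M) (sub σ N)
sub σ (lam M) = lam (sub (exts σ) M)

sub0 : Term → ℕ → Term
sub0 N zero = N
sub0 N (suc x) = var x

shift : Term → Term
shift = rename suc

infix 4 _=β_
data _=β_ : Term → Term → Set where
  β     : ∀ M N → app (lam M) N =β sub (sub0 N) M
  refl  : ∀ {M} → M =β M
  sym   : ∀ {M N} → M =β N → N =β M
  trans : ∀ {M N P} → M =β N → N =β P → M =β P
  appL  : ∀ {M M' N} → M =β M' → app M N =β app M' N
  appR  : ∀ {M N N'} → N =β N' → app M N =β app M N'
  lamC  : ∀ {M M'} → M =β M' → lam M =β lam M'

apps : Term → List Term → Term
apps M [] = M
apps M (N ∷ Ns) = apps (app M N) Ns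

lams : ℕ → Term → Term
lams zero M = M
lams (suc a) M = lam (lams a M)

iter : Term → ℕ → Term → Term
iter F zero z = z
iter F (suc k) z = app F (iter F k z)

Unsolvable : Term → Set
Unsolvable M = ∀ a y Ms → ¬ (M =β lams a (apps (var y) Ms))

data BTeq : ℕ → Term → Term → Set where
  bt0     : ∀ {M N} → BTeq zero M N
  btUns   : ∀ {k M N} → Unsolvable M → Unsolvable N → BTeq (suc k) M N
  btHnf   : ∀ {k M N} a y Ms Ns →
            M =β lams a (apps (var y) Ms) →
            N =β lams a (apps (var y) Ns) →
            Pointwise (BTeq k) Ms Ns →
            BTeq (suc k) M N

-- M =^∞ N : same Böhm tree (all finite truncations agree).
infix 4 _=∞_
_=∞_ : Term → Term → Set
M =∞ N = ∀ k → BTeq k M N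

-- Fixed point combinators (x = variable 0, fresh for shift Y).
FPC : Term → Set
FPC Y = app (shift Y) (var zero) =β app (var zero) (app (shift Y) (var zero))

WFPC : Term → Set
WFPC Y = app (shift Y) (var zero) =∞ app (var zero) (app (shift Y) (var zero))

_·⃗_ : ∀ {n} → Term → Vec Term (suc n) → Term
M ·⃗ G = apps M (toList G)

FGV : ∀ {n} → Vec Term (suc n) → Set
FGV G = ∀ Y → FPC Y → FPC (Y ·⃗ G)

-- compact: G₀^k(z) G₁ ⋯ Gₙ ∈ FPC, z = variable 0, fresh after shifting G⃗
Compact : ∀ {n} → Vec Term (suc n) → Set
Compact G = ∃ λ k →
  FPC (apps (iter (shift (head G)) k (var zero)) (map shift (toList (tail G))))

Rectifying : ∀ {n} → Vec Term (suc n) → Set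
Rectifying G = ∀ Y → WFPC Y → FPC (Y ·⃗ G)

{-# OPTIONS --safe #-}

-- Compact ⇒ rectifying: a wfpc Y satisfies Y x = x^k(N) for every k, so
-- Y G₀ = G₀^k(N[x := G₀]), and N[x := G₀] may be substituted for z.
--
-- Rectifying ⇒ compact: for a variable v not free in G⃗ put c₀ = v,
-- cᵢ₊₁ = cᵢ cᵢ, A = λc a f. f (a (c c) a f) and Y = A c₀ A.  Then
-- A cᵢ A f = f (A cᵢ₊₁ A f), so Y is a wfpc and Y G⃗ is an fpc.  A common
-- reduct of Y G⃗ x and x (Y G⃗ x) is reached in finitely many parallel steps,
-- and each of them raises the indices i by at most one.  If m bounds the
-- number of steps, the reductions survive the replacement of A cᵢ A by
-- T_{m-i}, where T₀ = λf. v and Tⱼ₊₁ = λf. f (Tⱼ f).  As v occurs only inside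
-- the replaced terms, the replacement is unambiguous and the two reductions
-- still meet; hence T_m G⃗ = G₀^m(v) G₁ ⋯ Gₙ is an fpc.
module Submission where

open import Defs
open import Data.Nat using (ℕ; zero; suc; pred; _+_; _⊔_; _≤_; _<_; s≤s; s≤s⁻¹; _<?_)
open import Data.Nat.Properties
  using (≤-refl; ≤-trans; m≤n⇒m≤1+n; m≤m⊔n; m≤n⊔m; m⊔n≤o⇒m≤o; m⊔n≤o⇒n≤o; n≮n; <⇒≢;
         m≤m+n; m≤n+m; n≤1+n; +-suc; +-cancelˡ-≡; suc-injective)
open import Data.Empty using (⊥-elim)
open import Data.List using (List; []; _∷_; map)
open import Data.List.Relation.Binary.Pointwise using ([]; _∷_)
open import Data.Product using (∃-syntax; _×_; _,_; proj₁; proj₂)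
open import Data.Vec using (Vec; _∷_; toList)
open import Function using (_∘_)
open import Function.Bundles using (_⇔_; mk⇔)
open import Relation.Binary.Construct.Closure.ReflexiveTransitive
  using (Star; ε; _◅_; _◅◅_; gmap)
open import Relation.Binary.PropositionalEquality as ≡
  using (_≡_; _≢_; cong; cong₂; subst; subst₂)
open import Relation.Nullary using (¬_; yes; no)

private variable
  M M' N N' P Q : Term
  Ms Ns : List Term
  σ τ υ : ℕ → Term
  ρ ρ' ρ'' : ℕ → ℕ

-- Substitution

-- Taking the composite as a pointwise hypothesis lets this law, and those below, pass under binders
-- without function extensionality.
rename-rename : (∀ x → ρ' (ρ x) ≡ ρ'' x) → ∀ M → rename ρ' (rename ρ M) ≡ rename ρ'' M
rename-rename h (var x) = cong var (h x)
rename-rename h (app M N) = cong₂ app (rename-rename h M) (rename-rename h N)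
rename-rename h (lam M) =
  cong lam (rename-rename (λ { zero → ≡.refl ; (suc x) → cong suc (h x) }) M)

sub-rename : (∀ x → σ (ρ x) ≡ τ x) → ∀ M → sub σ (rename ρ M) ≡ sub τ M
sub-rename h (var x) = h x
sub-rename h (app M N) = cong₂ app (sub-rename h M) (sub-rename h N)
sub-rename h (lam M) =
  cong lam (sub-rename (λ { zero → ≡.refl ; (suc x) → cong shift (h x) }) M)

shift-rename : ∀ M → rename (ext ρ) (shift M) ≡ shift (rename ρ M)
shift-rename M =
  ≡.trans (rename-rename (λ _ → ≡.refl) M) (≡.sym (rename-rename (λ _ → ≡.refl) M))

rename-sub : (∀ x → rename ρ (σ x) ≡ τ x) → ∀ M → rename ρ (sub σ M) ≡ sub τ M
rename-sub h (var x) = h x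
rename-sub h (app M N) = cong₂ app (rename-sub h M) (rename-sub h N)
rename-sub {σ = σ} h (lam M) =
  cong lam (rename-sub
    (λ { zero → ≡.refl
       ; (suc x) → ≡.trans (shift-rename (σ x)) (cong shift (h x)) }) M)

sub-shift : ∀ M → sub (exts σ) (shift M) ≡ shift (sub σ M)
sub-shift M =
  ≡.trans (sub-rename (λ _ → ≡.refl) M) (≡.sym (rename-sub (λ _ → ≡.refl) M))

sub-sub : (∀ x → sub τ (σ x) ≡ υ x) → ∀ M → sub τ (sub σ M) ≡ sub υ M
sub-sub h (var x) = h x
sub-sub h (app M N) = cong₂ app (sub-sub h M) (sub-sub h N)
sub-sub {σ = σ} h (lam M) =
  cong lam (sub-sub
    (λ { zero → ≡.refl
       ; (suc x) → ≡.trans (sub-shift (σ x)) (cong shift (h x)) }) M)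

sub-var : (∀ x → σ x ≡ var x) → ∀ M → sub σ M ≡ M
sub-var h (var x) = h x
sub-var h (app M N) = cong₂ app (sub-var h M) (sub-var h N)
sub-var h (lam M) =
  cong lam (sub-var (λ { zero → ≡.refl ; (suc x) → cong shift (h x) }) M)

sub0-shift : ∀ M → sub (sub0 N) (shift M) ≡ M
sub0-shift M = ≡.trans (sub-rename (λ _ → ≡.refl) M) (sub-var (λ _ → ≡.refl) M)

rename-sub0 : ∀ M → rename ρ (sub (sub0 N) M) ≡ sub (sub0 (rename ρ N)) (rename (ext ρ) M)
rename-sub0 M =
  ≡.trans (rename-sub (λ _ → ≡.refl) M)
    (≡.sym (sub-rename (λ { zero → ≡.refl ; (suc x) → ≡.refl }) M))

sub-sub0 : ∀ M → sub σ (sub (sub0 N) M) ≡ sub (sub0 (sub σ N)) (sub (exts σ) M)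
sub-sub0 {σ = σ} M =
  ≡.trans (sub-sub (λ _ → ≡.refl) M)
    (≡.sym (sub-sub (λ { zero → ≡.refl ; (suc x) → sub0-shift (σ x) }) M))

sub-apps : ∀ Ms → sub σ (apps M Ms) ≡ apps (sub σ M) (map (sub σ) Ms)
sub-apps [] = ≡.refl
sub-apps (_ ∷ Ms) = sub-apps Ms

sub-iter : ∀ k → sub σ (iter M k N) ≡ iter (sub σ M) k (sub σ N)
sub-iter zero = ≡.refl
sub-iter (suc k) = cong (app _) (sub-iter k)

map-sub0-shift : ∀ Ms → map (sub (sub0 N)) (map shift Ms) ≡ Ms
map-sub0-shift [] = ≡.refl
map-sub0-shift (M ∷ Ms) = cong₂ _∷_ (sub0-shift M) (map-sub0-shift Ms)

-- Conversion

reflexive : M ≡ N → M =β N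
reflexive ≡.refl = refl

sub-=β : ∀ σ → M =β N → sub σ M =β sub σ N
sub-=β σ (β M N) = trans (β _ _) (reflexive (≡.sym (sub-sub0 M)))
sub-=β σ refl = refl
sub-=β σ (sym p) = sym (sub-=β σ p)
sub-=β σ (trans p q) = trans (sub-=β σ p) (sub-=β σ q)
sub-=β σ (appL p) = appL (sub-=β σ p)
sub-=β σ (appR p) = appR (sub-=β σ p)
sub-=β σ (lamC p) = lamC (sub-=β (exts σ) p)

rename-=β : ∀ ρ → M =β N → rename ρ M =β rename ρ N
rename-=β ρ (β M N) = trans (β _ _) (reflexive (≡.sym (rename-sub0 M)))
rename-=β ρ refl = refl
rename-=β ρ (sym p) = sym (rename-=β ρ p)
rename-=β ρ (trans p q) = trans (rename-=β ρ p) (rename-=β ρ q)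
rename-=β ρ (appL p) = appL (rename-=β ρ p)
rename-=β ρ (appR p) = appR (rename-=β ρ p)
rename-=β ρ (lamC p) = lamC (rename-=β (ext ρ) p)

apps-=β : ∀ Ms → M =β N → apps M Ms =β apps N Ms
apps-=β [] p = p
apps-=β (_ ∷ Ms) p = apps-=β Ms (appL p)

iter-=β : ∀ k → N =β N' → iter M k N =β iter M k N'
iter-=β zero p = p
iter-=β (suc k) p = appR (iter-=β k p)

FPC-resp-=β : M =β N → FPC M → FPC N
FPC-resp-=β p h = trans (sym q) (trans h (appR q))
  where q = appL (rename-=β suc p)

-- The fresh variable 0 in `FPC` is fixed by `exts σ`, so the fixed point equation is carried to the
-- instance.
FPC-sub : ∀ σ M → FPC M → FPC (sub σ M)
FPC-sub σ M h =
  subst (λ L → app L (var 0) =β app (var 0) (app L (var 0))) (sub-shift M)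
    (sub-=β (exts σ) h)

-- Confluence

infix 4 _⇛_ _⇛*_

-- Parallel reduction in the style of Tait and Martin-Löf. The contractum in `pβ` is a variable with
-- an equation, so that matching on a step never has to unify with a `sub` term.
data _⇛_ : Term → Term → Set where
  pvar : ∀ {x} → var x ⇛ var x
  papp : M ⇛ M' → N ⇛ N' → app M N ⇛ app M' N'
  plam : M ⇛ M' → lam M ⇛ lam M'
  pβ   : M ⇛ M' → N ⇛ N' → P ≡ sub (sub0 N') M' → app (lam M) N ⇛ P

_⇛*_ : Term → Term → Set
_⇛*_ = Star _⇛_

⇛-refl : M ⇛ M
⇛-refl {var x} = pvar
⇛-refl {app M N} = papp ⇛-refl ⇛-refl
⇛-refl {lam M} = plam ⇛-refl

rename-⇛ : ∀ ρ → M ⇛ N → rename ρ M ⇛ rename ρ N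
rename-⇛ ρ pvar = pvar
rename-⇛ ρ (papp p q) = papp (rename-⇛ ρ p) (rename-⇛ ρ q)
rename-⇛ ρ (plam p) = plam (rename-⇛ (ext ρ) p)
rename-⇛ ρ (pβ {M' = M'} p q ≡.refl) =
  pβ (rename-⇛ (ext ρ) p) (rename-⇛ ρ q) (rename-sub0 M')

exts-⇛ : (∀ x → σ x ⇛ τ x) → ∀ x → exts σ x ⇛ exts τ x
exts-⇛ h zero = pvar
exts-⇛ h (suc x) = rename-⇛ suc (h x)

sub-⇛ : (∀ x → σ x ⇛ τ x) → M ⇛ N → sub σ M ⇛ sub τ N
sub-⇛ h (pvar {x}) = h x
sub-⇛ h (papp p q) = papp (sub-⇛ h p) (sub-⇛ h q)
sub-⇛ h (plam p) = plam (sub-⇛ (exts-⇛ h) p)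
sub-⇛ h (pβ {M' = M'} p q ≡.refl) = pβ (sub-⇛ (exts-⇛ h) p) (sub-⇛ h q) (sub-sub0 M')

sub0-⇛ : M ⇛ M' → N ⇛ N' → sub (sub0 N) M ⇛ sub (sub0 N') M'
sub0-⇛ p q = sub-⇛ (λ { zero → q ; (suc x) → pvar }) p

-- A redex contracted on one side only is contracted afterwards on the other; `sub0-⇛` joins the
-- contracta.
⇛-diamond : M ⇛ N → M ⇛ P → ∃[ Q ] (N ⇛ Q × P ⇛ Q)
⇛-diamond pvar pvar = _ , pvar , pvar
⇛-diamond (plam p) (plam q) with ⇛-diamond p q
... | _ , r , s = _ , plam r , plam s
⇛-diamond (papp p p') (papp q q') with ⇛-diamond p q | ⇛-diamond p' q'
... | _ , r , s | _ , r' , s' = _ , papp r r' , papp s s'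
⇛-diamond (papp (plam p) p') (pβ q q' ≡.refl) with ⇛-diamond p q | ⇛-diamond p' q'
... | _ , r , s | _ , r' , s' = _ , pβ r r' ≡.refl , sub0-⇛ s s'
⇛-diamond (pβ p p' ≡.refl) (papp (plam q) q') with ⇛-diamond p q | ⇛-diamond p' q'
... | _ , r , s | _ , r' , s' = _ , sub0-⇛ r r' , pβ s s' ≡.refl
⇛-diamond (pβ p p' ≡.refl) (pβ q q' ≡.refl) with ⇛-diamond p q | ⇛-diamond p' q'
... | _ , r , s | _ , r' , s' = _ , sub0-⇛ r r' , sub0-⇛ s s'

⇛-strip : M ⇛ N → M ⇛* P → ∃[ Q ] (N ⇛* Q × P ⇛ Q)
⇛-strip p ε = _ , ε , p
⇛-strip p (q ◅ qs) with ⇛-diamond p q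
... | _ , r , s with ⇛-strip s qs
... | _ , rs , t = _ , r ◅ rs , t

⇛*-confluent : M ⇛* N → M ⇛* P → ∃[ Q ] (N ⇛* Q × P ⇛* Q)
⇛*-confluent ε qs = _ , qs , ε
⇛*-confluent (p ◅ ps) qs with ⇛-strip p qs
... | _ , rs , s with ⇛*-confluent ps rs
... | _ , ts , us = _ , ts , s ◅ us

=β⇒joinable : M =β N → ∃[ Q ] (M ⇛* Q × N ⇛* Q)
=β⇒joinable (β M N) = _ , pβ ⇛-refl ⇛-refl ≡.refl ◅ ε , ε
=β⇒joinable refl = _ , ε , ε
=β⇒joinable (sym p) with =β⇒joinable p
... | _ , r , s = _ , s , r
=β⇒joinable (trans p q) with =β⇒joinable p | =β⇒joinable q
... | _ , r , s | _ , r' , s' with ⇛*-confluent s r'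
... | _ , t , t' = _ , r ◅◅ t , s' ◅◅ t'
=β⇒joinable (appL p) with =β⇒joinable p
... | _ , r , s = _ , gmap _ (λ q → papp q ⇛-refl) r , gmap _ (λ q → papp q ⇛-refl) s
=β⇒joinable (appR p) with =β⇒joinable p
... | _ , r , s = _ , gmap _ (papp ⇛-refl) r , gmap _ (papp ⇛-refl) s
=β⇒joinable (lamC p) with =β⇒joinable p
... | _ , r , s = _ , gmap lam plam r , gmap lam plam s

app-=β : M =β M' → N =β N' → app M N =β app M' N'
app-=β p q = trans (appL p) (appR q)

⇛⇒=β : M ⇛ N → M =β N
⇛⇒=β pvar = refl
⇛⇒=β (papp p q) = app-=β (⇛⇒=β p) (⇛⇒=β q)
⇛⇒=β (plam p) = lamC (⇛⇒=β p)
⇛⇒=β (pβ p q ≡.refl) = trans (app-=β (lamC (⇛⇒=β p)) (⇛⇒=β q)) (β _ _)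

⇛*⇒=β : M ⇛* N → M =β N
⇛*⇒=β ε = refl
⇛*⇒=β (p ◅ ps) = trans (⇛⇒=β p) (⇛*⇒=β ps)

-- Head normal forms

-- The index counts the arguments of the head variable. Reduction preserves it, which separates head
-- normal forms with different numbers of arguments.
data Neutral : ℕ → Term → Set where
  nvar : ∀ {x} → Neutral 0 (var x)
  napp : ∀ {n} → Neutral n M → Neutral (suc n) (app M N)

neutral-⇛* : ∀ {n} → Neutral n M → M ⇛* N → Neutral n N
neutral-⇛* h ε = h
neutral-⇛* h (p ◅ ps) = neutral-⇛* (step h p) ps
  where
  step : ∀ {n} → Neutral n M → M ⇛ N → Neutral n N
  step nvar pvar = nvar
  step (napp h) (papp p q) = napp (step h p)
  step (napp ()) (pβ _ _ _)

neutral-apps : ∀ {n} Ms → Neutral n M → ∃[ m ] (n ≤ m × Neutral m (apps M Ms))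
neutral-apps [] h = _ , ≤-refl , h
neutral-apps (_ ∷ Ms) h with neutral-apps Ms (napp h)
... | m , n<m , h' = m , ≤-trans (n≤1+n _) n<m , h'

lam-⇛* : lam M ⇛* N → ∃[ P ] N ≡ lam P
lam-⇛* ε = _ , ≡.refl
lam-⇛* (plam p ◅ ps) = lam-⇛* ps

var-app-⇛* : ∀ {x} → app (var x) M ⇛* N → ∃[ P ] (N ≡ app (var x) P × M ⇛* P)
var-app-⇛* ε = _ , ≡.refl , ε
var-app-⇛* (papp pvar p ◅ ps) with var-app-⇛* ps
... | P , e , qs = P , e , p ◅ qs

-- By confluence the two sides have a common reduct, and reduction of a head normal form keeps its
-- leading abstractions, head variable and number of arguments.
hnf-=β-var-app : ∀ a {x y} Ms → lams a (apps (var y) Ms) =β app (var x) N →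
                 ∃[ M ] (a ≡ 0 × y ≡ x × Ms ≡ M ∷ [] × M =β N)
hnf-=β-var-app a Ms p with =β⇒joinable p
... | _ , r , s with var-app-⇛* s
hnf-=β-var-app (suc a) Ms p | _ , r , s | _ , ≡.refl , s' with lam-⇛* r
... | _ , ()
hnf-=β-var-app zero [] p | _ , r , s | _ , ≡.refl , s' with neutral-⇛* nvar r
... | ()
hnf-=β-var-app zero (M ∷ []) p | _ , r , s | _ , ≡.refl , s' with var-app-⇛* r
... | _ , ≡.refl , r' = M , ≡.refl , ≡.refl , ≡.refl , trans (⇛*⇒=β r') (sym (⇛*⇒=β s'))
hnf-=β-var-app zero (_ ∷ _ ∷ Ms) p | _ , r , s | _ , ≡.refl , s'
  with neutral-apps Ms (napp (napp nvar))
... | _ , s≤s (s≤s _) , h with neutral-⇛* h r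
... | napp ()

-- Böhm trees of weak fixed points

BTeq-var-app : ∀ {k x} → BTeq (suc k) M P → P =β app (var x) N →
               ∃[ M' ] ∃[ N' ] (M =β app (var x) M' × N' =β N × BTeq k M' N')
-- `P` converts to a head normal form, so it is not unsolvable.
BTeq-var-app {x = x} (btUns _ u) p = ⊥-elim (u 0 x (_ ∷ []) p)
BTeq-var-app (btHnf a y Ms Ns p q eqs) r with hnf-=β-var-app a Ns (trans (sym q) r)
BTeq-var-app (btHnf _ _ (M ∷ []) _ p q (e ∷ [])) r | N , ≡.refl , ≡.refl , ≡.refl , s =
  M , N , p , s , e

BTeq-iter : ∀ {x} k → BTeq k M P → P =β iter (var x) k N → ∃[ M' ] M =β iter (var x) k M'
BTeq-iter {M = M} zero _ _ = M , refl
BTeq-iter (suc k) e p with BTeq-var-app e p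
... | _ , _ , q , r , e' with BTeq-iter k e' r
... | M' , s = M' , trans q (appR s)

-- Agreement to depth k+1 gives Yx = xM with M agreeing to depth k with Yx. By induction Yx is a
-- k-fold iterate of x, hence so is M, which adds one x in front.
WFPC-iter : ∀ Y → WFPC Y → ∀ k → ∃[ N ] app (shift Y) (var 0) =β iter (var 0) k N
WFPC-iter Y w zero = _ , refl
WFPC-iter Y w (suc k) with BTeq-var-app (w (suc k)) refl | WFPC-iter Y w k
... | _ , _ , p , q , e | N , r with BTeq-iter k e (trans q r)
... | M' , s = M' , trans p (appR s)

compact⇒rectifying : ∀ {n} (G : Vec Term (suc n)) → Compact G → Rectifying G
compact⇒rectifying (g ∷ gs) (k , c) Y w with WFPC-iter Y w k
... | N , p = FPC-resp-=β (apps-=β (toList gs) (sym Yg)) (subst FPC instance-eq (FPC-sub (sub0 Nᵍ) _ c))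
  where
  Nᵍ = sub (sub0 g) N
  Yg : app Y g =β iter g k Nᵍ
  Yg = subst₂ _=β_ (cong (λ L → app L g) (sub0-shift Y)) (sub-iter k) (sub-=β (sub0 g) p)
  instance-eq : sub (sub0 Nᵍ) (apps (iter (shift g) k (var 0)) (map shift (toList gs)))
              ≡ apps (iter g k Nᵍ) (toList gs)
  instance-eq =
    ≡.trans (sub-apps (map shift (toList gs)))
      (cong₂ apps (≡.trans (sub-iter k) (cong (λ L → iter L k Nᵍ) (sub0-shift g)))
                  (map-sub0-shift (toList gs)))

-- A weak fixed point combinator with a counter

A : Term
A = lam (lam (lam (app (var 0)
      (app (app (app (var 1) (app (var 2) (var 2))) (var 1)) (var 0)))))

-- The counters are normal forms headed by the variable `d`, so reduction never alters them, and
-- self-application advances them without any further constant.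
c : ℕ → ℕ → Term
c d zero = var d
c d (suc i) = app (c d i) (c d i)

-- The reduct of A cᵢ.
L : ℕ → ℕ → Term
L d i = lam (lam (app (var 0)
          (app (app (app (var 1) (c (2 + d) (suc i))) (var 1)) (var 0))))

W : ℕ → ℕ → Term
W d i = app (app A (c d i)) A

T : ℕ → ℕ → Term
T d zero = lam (var (suc d))
T d (suc j) = lam (app (var 0) (app (T (suc d) j) (var 0)))

rename-c : ∀ {d e} i → ρ d ≡ e → rename ρ (c d i) ≡ c e i
rename-c zero h = cong var h
rename-c (suc i) h = cong₂ app (rename-c i h) (rename-c i h)

sub-c : ∀ {d e} i → σ d ≡ var e → sub σ (c d i) ≡ c e i
sub-c zero h = h
sub-c (suc i) h = cong₂ app (sub-c i h) (sub-c i h)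

rename-T : ∀ {d e} j → ρ d ≡ e → rename ρ (T d j) ≡ T e j
rename-T zero h = cong (λ x → lam (var (suc x))) h
rename-T (suc j) h = cong (λ t → lam (app (var 0) (app t (var 0)))) (rename-T j (cong suc h))

sub-T : ∀ {d e} j → σ d ≡ var e → sub σ (T d j) ≡ T e j
sub-T zero h = cong (lam ∘ shift) h
sub-T (suc j) h = cong (λ t → lam (app (var 0) (app t (var 0)))) (sub-T j (cong shift h))

shift-c : ∀ {d} i → shift (c d i) ≡ c (suc d) i
shift-c i = rename-c i ≡.refl

sub-A-body : ∀ d i → sub (sub0 (c d i)) (lam (lam (app (var 0)
      (app (app (app (var 1) (app (var 2) (var 2))) (var 1)) (var 0))))) ≡ L d i
sub-A-body d i =
  cong (λ C → lam (lam (app (var 0) (app (app (app (var 1) (app C C)) (var 1)) (var 0)))))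
    (≡.trans (cong shift (shift-c i)) (shift-c i))

sub-L-body : ∀ d i → sub (sub0 A) (lam (app (var 0)
          (app (app (app (var 1) (c (2 + d) (suc i))) (var 1)) (var 0))))
        ≡ lam (app (var 0) (app (W (suc d) (suc i)) (var 0)))
sub-L-body d i =
  cong (λ C → lam (app (var 0) (app (app (app A C) A) (var 0)))) (sub-c (suc i) ≡.refl)

W-=β : ∀ d i → app (W d i) N =β app N (app (W d (suc i)) N)
W-=β {N} d i =
  trans (appL (trans (appL (trans (β _ _) (reflexive (sub-A-body d i))))
                     (trans (β _ _) (reflexive (sub-L-body d i)))))
    (trans (β _ _)
      (reflexive (cong (λ C → app N (app (app (app A C) A) N)) (sub-c (suc i) ≡.refl))))

W-WFPC : ∀ v → WFPC (W v 0)
W-WFPC v zero = bt0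
W-WFPC v (suc k) =
  btHnf 0 0 (_ ∷ []) (_ ∷ []) (W-=β (suc v) 0) refl (tails k 1 0 ∷ [])
  where
  -- Unfolding only the left side leaves the counters 1 and 0, so the induction must compare
  -- arbitrary counters; each unfolding emits the same head variable.
  tails : ∀ k i j → BTeq k (app (W (suc v) i) (var 0)) (app (W (suc v) j) (var 0))
  tails zero i j = bt0
  tails (suc k) i j =
    btHnf 0 0 (_ ∷ []) (_ ∷ []) (W-=β (suc v) i) (W-=β (suc v) j) (tails k (suc i) (suc j) ∷ [])

-- The innermost `T` discards its argument and leaves `v`, which yields the iterate from the
-- definition of compactness.
T-=β : ∀ v j → app (T v j) N =β iter N j (var v)
T-=β v zero = β _ _
T-=β {N} v (suc j) =
  trans (β _ _)
    (trans (reflexive (cong (λ t → app N (app t N)) (sub-T j ≡.refl))) (appR (T-=β v j)))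

-- Truncation

-- Two contractions separate one counter value from the next: the first feeds the counter to `A`,
-- and only the second exposes the output and the next counter.
data State : ℕ → ℕ → Term → Set where
  initial : ∀ {d i} → State d i (W d i)
  applied : ∀ {d i} → State d i (app (L d i) A)

-- Trunc m q d M N: N arises from M by replacing the states with counter cᵢ,
-- built from the variable d, by T_{m-i}; here q bounds the m - i from below
-- and d has no other occurrence in M.
data Trunc (m q : ℕ) : ℕ → Term → Term → Set where
  tvar   : ∀ {d x} → x ≢ d → Trunc m q d (var x) (var x)
  tapp   : ∀ {d} → Trunc m q d M M' → Trunc m q d N N' → Trunc m q d (app M N) (app M' N')
  tlam   : ∀ {d} → Trunc m q (suc d) M M' → Trunc m q d (lam M) (lam M')
  tstate : ∀ {d i j} → State d i M → i + j ≡ m → q ≤ j → Trunc m q d M (T d j)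

private variable
  m q d e : ℕ

Trunc-mono : ∀ {r} → q ≤ r → Trunc m r d M N → Trunc m q d M N
Trunc-mono h (tvar x≢d) = tvar x≢d
Trunc-mono h (tapp s t) = tapp (Trunc-mono h s) (Trunc-mono h t)
Trunc-mono h (tlam t) = tlam (Trunc-mono h t)
Trunc-mono h (tstate s e r≤j) = tstate s e (≤-trans h r≤j)

rename-State : ∀ {i} → ρ d ≡ e → State d i M → State e i (rename ρ M)
rename-State {d = d} {e = e} {i = i} h initial =
  subst (λ C → State e i (app (app A C) A)) (≡.sym (rename-c i h)) initial
rename-State {d = d} {e = e} {i = i} h applied =
  subst (λ C → State e i (app (lam (lam (app (var 0) (app (app (app (var 1) C) (var 1)) (var 0))))) A))
    (≡.sym (rename-c (suc i) (cong (λ x → suc (suc x)) h))) applied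

sub-State : ∀ {i} → σ d ≡ var e → State d i M → State e i (sub σ M)
sub-State {d = d} {e = e} {i = i} h initial =
  subst (λ C → State e i (app (app A C) A)) (≡.sym (sub-c i h)) initial
sub-State {d = d} {e = e} {i = i} h applied =
  subst (λ C → State e i (app (lam (lam (app (var 0) (app (app (app (var 1) C) (var 1)) (var 0))))) A))
    (≡.sym (sub-c (suc i) (cong (shift ∘ shift) h))) applied

-- The second hypothesis keeps every other variable away from the reserved one.
rename-Trunc : ρ d ≡ e → (∀ x → x ≢ d → ρ x ≢ e) →
               Trunc m q d M N → Trunc m q e (rename ρ M) (rename ρ N)
rename-Trunc h k (tvar x≢d) = tvar (k _ x≢d)
rename-Trunc h k (tapp s t) = tapp (rename-Trunc h k s) (rename-Trunc h k t)
rename-Trunc {ρ = ρ} {d = d} {e = e} h k (tlam t) = tlam (rename-Trunc (cong suc h) k' t)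
  where
  k' : ∀ x → x ≢ suc d → ext ρ x ≢ suc e
  k' zero _ ()
  k' (suc x) x≢d eq = k x (x≢d ∘ cong suc) (suc-injective eq)
rename-Trunc {m = m} {q = q} h k (tstate {j = j} s i+j≡m q≤j) =
  subst (Trunc m q _ _) (≡.sym (rename-T j h)) (tstate (rename-State h s) i+j≡m q≤j)

shift-Trunc : Trunc m q d M N → Trunc m q (suc d) (shift M) (shift N)
shift-Trunc = rename-Trunc ≡.refl (λ x x≢d → x≢d ∘ suc-injective)

-- Both substitutions send the reserved variable to a variable, so states remain states with the
-- same counter.
sub-Trunc : σ d ≡ var e → τ d ≡ var e → (∀ x → x ≢ d → Trunc m q e (σ x) (τ x)) →
            Trunc m q d M N → Trunc m q e (sub σ M) (sub τ N)
sub-Trunc h h' k (tvar x≢d) = k _ x≢d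
sub-Trunc h h' k (tapp s t) = tapp (sub-Trunc h h' k s) (sub-Trunc h h' k t)
sub-Trunc h h' k (tlam t) =
  tlam (sub-Trunc (cong shift h) (cong shift h')
    (λ { zero _ → tvar (λ ()) ; (suc x) x≢d → shift-Trunc (k x (x≢d ∘ cong suc)) }) t)
sub-Trunc {m = m} {q = q} h h' k (tstate {j = j} s i+j≡m q≤j) =
  subst (Trunc m q _ _) (≡.sym (sub-T j h')) (tstate (sub-State h s) i+j≡m q≤j)

sub0-Trunc : Trunc m q (suc d) M M' → Trunc m q d N N' →
             Trunc m q d (sub (sub0 N) M) (sub (sub0 N') M')
sub0-Trunc s t =
  sub-Trunc ≡.refl ≡.refl (λ { zero _ → t ; (suc x) x≢d → tvar (x≢d ∘ cong suc) }) s

-- Truncation along parallel reduction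

A-normal : A ⇛ M → M ≡ A
A-normal (plam (plam (plam (papp pvar
  (papp (papp (papp pvar (papp pvar pvar)) pvar) pvar))))) = ≡.refl

c-normal : ∀ d i → c d i ⇛ M → M ≡ c d i
c-normal d zero pvar = ≡.refl
-- Splitting `i` further exposes the function part of the application, which is never an
-- abstraction; this excludes `pβ`.
c-normal d (suc zero) (papp p q) = cong₂ app (c-normal d zero p) (c-normal d zero q)
c-normal d (suc (suc i)) (papp p q) = cong₂ app (c-normal d (suc i) p) (c-normal d (suc i) q)

L-normal : ∀ d i → L d i ⇛ M → M ≡ L d i
L-normal d i (plam (plam (papp pvar (papp (papp (papp pvar p) pvar) pvar)))) =
  cong (λ C → lam (lam (app (var 0) (app (app (app (var 1) C) (var 1)) (var 0)))))
    (c-normal _ (suc i) p)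

State-⇛ : ∀ {i j} → State d i M → i + j ≡ m → q < j → M ⇛ N → Trunc m q d N (T d j)
State-⇛ {i = i} initial eq q<j (papp (papp p p') p'')
  rewrite A-normal p | c-normal _ i p' | A-normal p'' =
  tstate initial eq (≤-trans (n≤1+n _) q<j)
State-⇛ {d = d} {i = i} initial eq q<j (papp (pβ (plam (plam (papp pvar
  (papp (papp (papp pvar (papp pvar pvar)) pvar) pvar)))) p' ≡.refl) p'')
  rewrite c-normal _ i p' | sub-A-body d i | A-normal p'' =
  tstate applied eq (≤-trans (n≤1+n _) q<j)
State-⇛ {i = i} applied eq q<j (papp p p')
  rewrite L-normal _ i p | A-normal p' =
  tstate applied eq (≤-trans (n≤1+n _) q<j)
-- Here the counter advances. Since `q < j`, the index is a successor and its `T` already has the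
-- shape of the contractum, so the truncated side need not reduce; `i` rises as `j` falls, keeping
-- their sum.
State-⇛ {d = d} {m = m} {i = i} {j = suc j} applied eq (s≤s q≤j)
  (pβ (plam (papp pvar (papp (papp (papp pvar p) pvar) pvar))) p' ≡.refl)
  rewrite c-normal _ (suc i) p | A-normal p' | sub-L-body d i =
  tlam (tapp (tvar λ ())
    (tapp (tstate initial (≡.trans (≡.sym (+-suc i j)) eq) q≤j) (tvar λ ())))

-- A state is an application, so the abstraction of a redex that is truncated componentwise stays an
-- abstraction and the step can be copied. Inside a state the truncated side stands still, at the
-- cost of one unit of the bound.
Trunc-⇛ : Trunc m (suc q) d M N → M ⇛ M' → ∃[ N' ] (N ⇛ N' × Trunc m q d M' N')
Trunc-⇛ (tvar x≢d) pvar = _ , pvar , tvar x≢d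
Trunc-⇛ (tapp s t) (papp p r) with Trunc-⇛ s p | Trunc-⇛ t r
... | _ , p' , s' | _ , r' , t' = _ , papp p' r' , tapp s' t'
Trunc-⇛ (tapp (tlam s) t) (pβ p r ≡.refl) with Trunc-⇛ s p | Trunc-⇛ t r
... | _ , p' , s' | _ , r' , t' = _ , pβ p' r' ≡.refl , sub0-Trunc s' t'
Trunc-⇛ (tlam t) (plam p) with Trunc-⇛ t p
... | _ , p' , t' = _ , plam p' , tlam t'
Trunc-⇛ (tstate s eq q<j) p = _ , ⇛-refl , State-⇛ s eq q<j p

steps : M ⇛* N → ℕ
steps ε = 0
steps (_ ◅ ps) = suc (steps ps)

Trunc-⇛* : (ps : M ⇛* M') → Trunc m (steps ps) d M N → ∃[ N' ] (N =β N' × Trunc m 0 d M' N')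
Trunc-⇛* ε t = _ , refl , t
Trunc-⇛* (p ◅ ps) t with Trunc-⇛ t p
... | _ , p' , t' with Trunc-⇛* ps t'
... | _ , r , t'' = _ , trans (⇛⇒=β p') r , t''

-- Uniqueness of truncations

State-arg : ∀ {i} → State d i (app P Q) → Q ≡ A
State-arg initial = ≡.refl
State-arg applied = ≡.refl

c≢A : ∀ d i → c d i ≢ A
c≢A d zero ()
c≢A d (suc i) ()

-- A counter consists of the reserved variable alone, which `tvar` rejects, and it cannot be a state
-- because the last argument of a state is `A`.
c-not-Trunc : ∀ i → ¬ Trunc m q d (c d i) N
c-not-Trunc zero (tvar d≢d) = d≢d ≡.refl
c-not-Trunc (suc i) (tapp s _) = c-not-Trunc i s
c-not-Trunc {d = d} (suc i) (tstate s _ _) = c≢A d i (State-arg s)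

-- Truncating a state componentwise would require truncating the counter inside it.
state-not-tapp : ∀ {i} → State d i (app M N) → Trunc m q d M M' → ¬ Trunc m q d N N'
state-not-tapp {i = i} initial (tapp _ t) _ = c-not-Trunc i t
state-not-tapp {d = d} {i = i} initial (tstate s _ _) _ = c≢A d i (State-arg s)
state-not-tapp {i = i} applied (tlam (tlam (tapp _ (tapp (tapp (tapp _ t) _) _)))) _ =
  c-not-Trunc (suc i) t
state-not-tapp applied (tlam (tlam (tapp _ (tapp (tapp (tstate s _ _) _) _)))) _
  with State-arg s
... | ()
state-not-tapp applied (tlam (tlam (tapp _ (tapp (tstate s _ _) _)))) _ with State-arg s
... | ()
state-not-tapp applied (tlam (tlam (tapp _ (tstate s _ _)))) _ with State-arg s
... | ()
state-not-tapp applied (tlam (tlam (tstate s _ _))) _ with State-arg s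
... | ()

depth : Term → ℕ
depth (app M _) = suc (depth M)
depth _ = 0

depth-c : ∀ d i → depth (c d i) ≡ i
depth-c d zero = ≡.refl
depth-c d (suc i) = cong suc (depth-c d i)

counter : Term → ℕ
counter (app (app _ C) _) = depth C
-- The term `L d i` already holds the successor counter, hence `pred`.
counter (app (lam (lam (app _ (app (app (app _ C) _) _)))) _) = pred (depth C)
counter _ = 0

State-counter : ∀ {i} → State d i M → counter M ≡ i
State-counter {d} {i = i} initial = depth-c d i
State-counter {d} {i = i} applied = depth-c (2 + d) i

-- The rules for states and applications do not overlap, and a state determines its counter `i`,
-- hence also `j` from `i + j ≡ m`.
Trunc-functional : Trunc m q d M N → Trunc m q d M N' → N ≡ N'
Trunc-functional (tvar _) (tvar _) = ≡.refl
Trunc-functional (tapp s t) (tapp s' t') =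
  cong₂ app (Trunc-functional s s') (Trunc-functional t t')
Trunc-functional (tapp s t) (tstate r _ _) = ⊥-elim (state-not-tapp r s t)
Trunc-functional (tlam t) (tlam t') = cong lam (Trunc-functional t t')
Trunc-functional (tstate r _ _) (tapp s t) = ⊥-elim (state-not-tapp r s t)
Trunc-functional {d = d} (tstate {i = i} r eq _) (tstate r' eq' _)
  with ≡.trans (≡.sym (State-counter r)) (State-counter r')
... | ≡.refl = cong (T d) (+-cancelˡ-≡ i _ _ (≡.trans eq (≡.sym eq')))

-- Freshness

-- A strict upper bound for all variables, bound ones included.
bound : Term → ℕ
bound (var x) = suc x
bound (app M N) = bound M ⊔ bound N
bound (lam M) = bound M

bounds : List Term → ℕ
bounds [] = 0
bounds (M ∷ Ms) = bound M ⊔ bounds Ms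

-- Under `lam` the reserved index rises while `bound` stays the same, so the inequality persists.
Trunc-fresh : ∀ M → bound M ≤ d → Trunc m q d M M
Trunc-fresh (var x) h = tvar (<⇒≢ h)
Trunc-fresh (app M N) h =
  tapp (Trunc-fresh M (m⊔n≤o⇒m≤o (bound M) _ h)) (Trunc-fresh N (m⊔n≤o⇒n≤o (bound M) _ h))
Trunc-fresh (lam M) h = tlam (Trunc-fresh M (m≤n⇒m≤1+n h))

Trunc-apps : ∀ Ms → bounds Ms ≤ d → Trunc m q d M N → Trunc m q d (apps M Ms) (apps N Ms)
Trunc-apps [] h t = t
Trunc-apps (M ∷ Ms) h t =
  Trunc-apps Ms (m⊔n≤o⇒n≤o (bound M) _ h) (tapp t (Trunc-fresh M (m⊔n≤o⇒m≤o (bound M) _ h)))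

sub-fresh : (∀ x → x < d → σ x ≡ var (ρ x)) → ∀ M → bound M ≤ d → sub σ M ≡ rename ρ M
sub-fresh k (var x) h = k x h
sub-fresh k (app M N) h =
  cong₂ app (sub-fresh k M (m⊔n≤o⇒m≤o (bound M) _ h)) (sub-fresh k N (m⊔n≤o⇒n≤o (bound M) _ h))
sub-fresh k (lam M) h =
  cong lam (sub-fresh
    (λ { zero _ → ≡.refl ; (suc x) x<d → cong shift (k x (s≤s⁻¹ x<d)) })
    M (m≤n⇒m≤1+n h))

map-sub-fresh : (∀ x → x < d → σ x ≡ var (ρ x)) →
                ∀ Ms → bounds Ms ≤ d → map (sub σ) Ms ≡ map (rename ρ) Ms
map-sub-fresh k [] h = ≡.refl
map-sub-fresh k (M ∷ Ms) h =
  cong₂ _∷_ (sub-fresh k M (m⊔n≤o⇒m≤o (bound M) _ h))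
            (map-sub-fresh k Ms (m⊔n≤o⇒n≤o (bound M) _ h))

-- Moves the reserved variable `v` to the index 0 used in `Compact` and shifts all variables below
-- it. The value above `v` is arbitrary, as no such variable is free in the terms concerned.
toZero : ℕ → ℕ → Term
toZero v x with x <? v
... | yes _ = var (suc x)
... | no _  = var 0

toZero-< : ∀ v x → x < v → toZero v x ≡ var (suc x)
toZero-< v x x<v with x <? v
... | yes _ = ≡.refl
... | no x≮v = ⊥-elim (x≮v x<v)

toZero-self : ∀ v → toZero v v ≡ var 0
toZero-self v with v <? v
... | yes v<v = ⊥-elim (n≮n v v<v)
... | no _ = ≡.refl

-- Rectifying implies compact

truncated-FPC : ∀ v Gs → bounds Gs ≤ v → FPC (apps (W v 0) Gs) → ∃[ m ] FPC (apps (T v m) Gs)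
truncated-FPC v Gs fresh h with =β⇒joinable h
... | R , ps , qs = k , trans Zx=N (trans (reflexive N≡N') (sym xZx=N'))
  where
  -- Both sides of the equation must contain the same `T v k`, so one number has to bound the
  -- lengths of both reductions.
  k = steps ps + steps qs
  Zx : Trunc k k (suc v) (app (shift (apps (W v 0) Gs)) (var 0))
                         (app (shift (apps (T v k) Gs)) (var 0))
  Zx = tapp (shift-Trunc (Trunc-apps Gs fresh (tstate initial ≡.refl ≤-refl))) (tvar λ ())
  left = Trunc-⇛* ps (Trunc-mono (m≤m+n _ _) Zx)
  right = Trunc-⇛* qs (Trunc-mono (m≤n+m _ (steps ps)) (tapp (tvar λ ()) Zx))
  Zx=N = proj₁ (proj₂ left)
  xZx=N' = proj₁ (proj₂ right)
  N≡N' = Trunc-functional (proj₂ (proj₂ left)) (proj₂ (proj₂ right))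

rectifying⇒compact : ∀ {n} (G : Vec Term (suc n)) → Rectifying G → Compact G
rectifying⇒compact (g ∷ gs) rect =
  k , subst FPC instance-eq (FPC-sub (toZero v) _ (FPC-resp-=β (apps-=β Gs (T-=β v k)) fpc))
  where
  Gs = toList gs
  v = bounds (g ∷ Gs)
  truncated = truncated-FPC v (g ∷ Gs) ≤-refl (rect (W v 0) (W-WFPC v))
  k = proj₁ truncated
  fpc = proj₂ truncated
  instance-eq : sub (toZero v) (apps (iter g k (var v)) Gs)
              ≡ apps (iter (shift g) k (var 0)) (map shift Gs)
  instance-eq =
    ≡.trans (sub-apps Gs)
      (cong₂ apps
        (≡.trans (sub-iter k)
          (cong₂ (λ F z → iter F k z)
            (sub-fresh (toZero-< v) g (m≤m⊔n _ _)) (toZero-self v)))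
        (map-sub-fresh (toZero-< v) Gs (m≤n⊔m (bound g) _)))

theorem5p3 : (n : ℕ) (G : Vec Term (suc n)) → FGV G → (Compact G ⇔ Rectifying G)
theorem5p3 n G _ = mk⇔ (compact⇒rectifying G) (rectifying⇒compact G)
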